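{- Let $\Gamma$ be a MaxSAT instance encoded with blocking variables $b_1,\dots,b_m$, with $\mathrm{cost}(\Gamma)=k$. Then there is a derivation in the cost-SPR calculus from $\Gamma$ of the unit clauses $b_{i_1},\dots,b_{i_k}$ for some $k$ distinct indices $i_1,\dots,i_k$ and of all unit clauses $\lnot b_j$ for $j\notin\{i_1,\dots,i_k\}$.
   Context: Literals, clauses, CNFs (multisets of clauses), $\mathrm{Var}(\Gamma)$. A substitution $\sigma$ maps each variable to $0$, $1$ or a literal, extended by $\sigma(\lnot x)=\lnot\sigma(x)$, $\sigma(0)=0$, $\sigma(1)=1$; $(\sigma\circ\tau)(x)=\sigma(\tau(x))$. A (partial) assignment has $\sigma(x)\in\{0,1,x\}$; its domain is $\sigma^{ -1}(\{0,1\})$; total means all variables get Boolean values. $C{\upharpoonright}_\sigma$: apply $\sigma$ to each literal and simplify; $\sigma\models C$ if the result is $1$ or tautological; $\Gamma{\upharpoonright}_\sigma$ is the multiset of $C{\upharpoonright}_\sigma\neq1$ for $C\in\Gamma$. $\lnot C$ is the partial assignment falsifying all literals of $C$; $\tau\supseteq\rho$ means $\tau$ extends $\rho$. $\Gamma\vdash_1 C$ means unit propagation on $\Gamma{\upharpoonright}_{\lnot C}$ derives the empty clause; $\Gamma\vdash_1\Delta$ means $\Gamma\vdash_1 D$ for all $D\in\Delta$. A MaxSAT instance encoded with blocking variables is a CNF $\Gamma=H\cup\{C_1\lor b_1,\dots,C_m\lor b_m\}$ with distinct fresh variables $b_i$ (blocking variables). $\mathrm{cost}(\alpha)=\sum_i\alpha(b_i)$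 for total $\alpha$; $\mathrm{cost}(\Gamma)=\min\{\mathrm{cost}(\alpha):\alpha\models\Gamma\}$. A clause $C$ is cost-SR w.r.t. $\Gamma$ via $\sigma$ if (1) $\Gamma{\upharpoonright}_{\lnot C}\vdash_1(\Gamma\cup\{C\}){\upharpoonright}_\sigma$ and (2) $\mathrm{cost}(\tau\circ\sigma)\le\mathrm{cost}(\tau)$ for all total $\tau\supseteq\lnot C$. It is cost-SPR if such a $\sigma$ exists that is a partial assignment with the same domain as $\lnot C$. A derivation in the cost-SPR calculus from $\Gamma$ is a sequence $D_1,\dots,D_t$ where each $D_i$ is in $\Gamma$, or follows from earlier clauses by weakening or resolution, or is cost-SPR w.r.t. $\Gamma\cup\{D_1,\dots,D_{i-1}\}$ with $\mathrm{Var}(D_i)\subseteq\mathrm{Var}(\Gamma)$. -}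

module Defs where

open import Data.Bool.Base using (Bool; true; false; not; if_then_else_)
open import Data.Fin.Base using (Fin)
open import Data.List.Base
  using (List; []; _∷_; [_]; _++_; map; concatMap; foldr; mapMaybe; tabulate)
open import Data.List.Membership.Propositional using (_∈_; _∉_)
import Data.List.Membership.DecPropositional as DecMembership
open import Data.List.Relation.Binary.BagAndSetEquality using (_∼[_]_; set)
open import Data.List.Relation.Binary.Subset.Propositional using (_⊆_)
open import Data.List.Relation.Unary.All using (All)
open import Data.Maybe.Base using (Maybe; just; nothing)
open import Data.Nat.Base using (ℕ; _≤_)
open import Data.Nat.ListAction using (sum)
open import Data.Product.Base using (_×_; ∃; ∃-syntax)
open import Data.Sum.Base using (_⊎_)
open import Function.Bundles using (_⇔_)
open import Function.Definitions using (Injective)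
open import Relation.Binary.Definitions using (DecidableEquality)
open import Relation.Binary.PropositionalEquality using (_≡_; refl)
open import Relation.Nullary using (¬_; yes; no; ⌊_⌋)

module CostSPR {V : Set} (_≟_ : DecidableEquality V) where

  data Literal : Set where
    pos neg : V → Literal

  var : Literal → V
  var (pos x) = x
  var (neg x) = x

  complement : Literal → Literal
  complement (pos x) = neg x
  complement (neg x) = pos x

  _≟ˡ_ : DecidableEquality Literal
  pos x ≟ˡ pos y with x ≟ y
  ... | yes refl = yes refl
  ... | no  x≢y  = no λ { refl → x≢y refl }
  pos _ ≟ˡ neg _ = no λ ()
  neg _ ≟ˡ pos _ = no λ ()
  neg x ≟ˡ neg y with x ≟ y
  ... | yes refl = yes refl
  ... | no  x≢y  = no λ { refl → x≢y refl }

  open DecMembership _≟ˡ_ using (_∈?_)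

  -- A clause is a set of literals: two lists denote the same clause when they
  -- are related by _≈_, and every notion below respects this (in particular,
  -- ℓ ∷ ℓ ∷ [] is a unit clause).  A CNF is a multiset of clauses; nothing
  -- below depends on the order of its list.
  Clause : Set
  Clause = List Literal

  CNF : Set
  CNF = List Clause

  _≈_ : Clause → Clause → Set
  C ≈ D = C ∼[ set ] D

  vars : Clause → List V
  vars = map var

  Var : CNF → List V
  Var = concatMap vars

  Tautological : Clause → Set
  Tautological C = ∃[ x ] (pos x ∈ C × neg x ∈ C)

  data Value : Set where
    bool : Bool → Value
    lit  : Literal → Value

  notᵛ : Value → Value
  notᵛ (bool v) = bool (not v)
  notᵛ (lit ℓ)  = lit (complement ℓ)

  Substitution : Set
  Substitution = V → Value

  applyˡ : Substitution → Literal → Value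
  applyˡ σ (pos x) = σ x
  applyˡ σ (neg x) = notᵛ (σ x)

  applyᵛ : Substitution → Value → Value
  applyᵛ σ (bool v) = bool v
  applyᵛ σ (lit ℓ)  = applyˡ σ ℓ

  infixr 9 _∘ˢ_
  _∘ˢ_ : Substitution → Substitution → Substitution
  (σ ∘ˢ τ) x = applyᵛ σ (τ x)

  IsAssignment : Substitution → Set
  IsAssignment σ = ∀ x → (∃[ v ] σ x ≡ bool v) ⊎ σ x ≡ lit (pos x)

  Dom : Substitution → V → Set
  Dom σ x = ∃[ v ] σ x ≡ bool v

  Total : Substitution → Set
  Total σ = ∀ x → Dom σ x

  _⊇ᵃ_ : Substitution → Substitution → Set
  τ ⊇ᵃ ρ = ∀ x v → ρ x ≡ bool v → τ x ≡ bool v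

  -- Disjunction with the rules D ∨ 0 = D and D ∨ 1 = 1, where nothing stands
  -- for the constant 1.  The rule D ∨ ℓ ∨ ℓ = D ∨ ℓ is part of _≈_.
  infixr 6 _∨ᵛ_
  _∨ᵛ_ : Value → Maybe Clause → Maybe Clause
  _          ∨ᵛ nothing = nothing
  bool true  ∨ᵛ just C  = nothing
  bool false ∨ᵛ just C  = just C
  lit ℓ      ∨ᵛ just C  = just (ℓ ∷ C)

  infixl 7 _↾ᶜ_ _↾_
  _↾ᶜ_ : Clause → Substitution → Maybe Clause
  C ↾ᶜ σ = foldr (λ ℓ D → applyˡ σ ℓ ∨ᵛ D) (just []) C

  _↾_ : CNF → Substitution → CNF
  Γ ↾ σ = mapMaybe (_↾ᶜ σ) Γ

  infix 4 _⊨ᶜ_ _⊨_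
  _⊨ᶜ_ : Substitution → Clause → Set
  σ ⊨ᶜ C = (C ↾ᶜ σ ≡ nothing) ⊎ (∃[ D ] (C ↾ᶜ σ ≡ just D × Tautological D))

  _⊨_ : Substitution → CNF → Set
  σ ⊨ Γ = All (σ ⊨ᶜ_) Γ

  -- The partial assignment ¬C.  No assignment falsifies a tautological clause,
  -- so ¬̇ C is meaningful only for non-tautological C.
  ¬̇_ : Clause → Substitution
  (¬̇ C) x = if ⌊ pos x ∈? C ⌋ then bool false
            else if ⌊ neg x ∈? C ⌋ then bool true
            else lit (pos x)

  -- ¬̇ [ complement ℓ ] is the assignment setting ℓ to 1.
  data UnitRefutable (Γ : CNF) : Set where
    conflict  : [] ∈ Γ → UnitRefutable Γ
    propagate : ∀ {C} ℓ → C ∈ Γ → C ≈ [ ℓ ] →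
                UnitRefutable (Γ ↾ (¬̇ [ complement ℓ ])) → UnitRefutable Γ

  -- Tautological clauses, for which ¬C is undefined, count as implied.
  infix 4 _⊢₁_ _⊢₁*_
  _⊢₁_ : CNF → Clause → Set
  Γ ⊢₁ C = Tautological C ⊎ UnitRefutable (Γ ↾ (¬̇ C))

  _⊢₁*_ : CNF → CNF → Set
  Γ ⊢₁* Δ = All (Γ ⊢₁_) Δ

  record MaxSATInstance (m : ℕ) : Set where
    field
      hard       : CNF
      soft       : Fin m → Clause
      b          : Fin m → V
      b-distinct : Injective _≡_ _≡_ b
      b-hard     : ∀ i → b i ∉ Var hard
      b-soft     : ∀ i j → b i ∉ vars (soft j)

    cnf : CNF
    cnf = hard ++ tabulate (λ i → soft i ++ [ pos (b i) ])

  -- Only used for total substitutions, so the last clause is never reached.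
  toℕ : Value → ℕ
  toℕ (bool true)  = 1
  toℕ (bool false) = 0
  toℕ (lit _)      = 0

  module _ {m : ℕ} (b : Fin m → V) where

    cost : Substitution → ℕ
    cost α = sum (tabulate (λ i → toℕ (α (b i))))

    -- cost(Γ) = k, i.e. k is the minimum of cost(α) over total α ⊨ Γ.
    HasCost : CNF → ℕ → Set
    HasCost Γ k =
      (∃[ α ] (Total α × α ⊨ Γ × cost α ≡ k)) ×
      (∀ α → Total α → α ⊨ Γ → k ≤ cost α)

    record CostSRVia (Γ : CNF) (C : Clause) (σ : Substitution) : Set where
      field
        -- needed for ¬C to be an assignment
        nontautological : ¬ Tautological C
        implied         : Γ ↾ (¬̇ C) ⊢₁* (C ∷ Γ) ↾ σ
        cost-≤          : ∀ τ → Total τ → τ ⊇ᵃ (¬̇ C) →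
                          cost (τ ∘ˢ σ) ≤ cost τ

    CostSPR : CNF → Clause → Set
    CostSPR Γ C =
      ∃[ σ ] (IsAssignment σ × (∀ x → Dom σ x ⇔ Dom (¬̇ C) x) × CostSRVia Γ C σ)

    data Step (Γ : CNF) (Ds : List Clause) (D : Clause) : Set where
      axiom      : ∀ {C} → C ∈ Γ → C ≈ D → Step Γ Ds D
      weakening  : ∀ {C} → C ∈ Ds → C ⊆ D → Step Γ Ds D
      resolution : ∀ {E F} x A B → E ∈ Ds → F ∈ Ds →
                   E ≈ (pos x ∷ A) → F ≈ (neg x ∷ B) → (A ++ B) ≈ D →
                   Step Γ Ds D
      redundancy : CostSPR (Γ ++ Ds) D → vars D ⊆ Var Γ → Step Γ Ds D

    -- The sequence D₁, …, D_t is indexed by the list D_t ∷ … ∷ D₁ ∷ [].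
    data Derivation (Γ : CNF) : List Clause → Set where
      []  : Derivation Γ []
      _∷_ : ∀ {D Ds} → Step Γ Ds D → Derivation Γ Ds → Derivation Γ (D ∷ Ds)

{-# OPTIONS --safe #-}
module Submission where

-- Fix an optimal total assignment α.  Every non-tautological clause D over Var Γ
-- that α satisfies is derivable.  If D mentions all variables of Γ, then either
-- D contains a clause of Γ and is a weakening of it, or every total extension τ
-- of ¬D satisfies Γ, so cost τ ≥ cost α, and D is cost-SPR via α restricted to Var Γ:
-- this substitution satisfies Γ, D and everything derived so far, so condition (1)
-- is vacuous.  Other clauses follow by resolving on the missing variables.

open import Defs
open import Data.Bool.Base using (Bool; true; false; if_then_else_)
open import Data.Bool.Properties using (¬-not)
open import Data.Empty using (⊥-elim)
open import Data.Fin.Base using (Fin; zero; suc)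
open import Data.Nat.Base using (ℕ; suc; _≤_)
open import Data.Nat.ListAction using (sum)
open import Data.Nat.Properties using (≤-reflexive; ≤-trans)
open import Data.Fin.Subset using (Subset; ∣_∣) renaming (_∈_ to _∈ˢ_; _∉_ to _∉ˢ_)
open import Data.List.Base using (List; []; _∷_; [_]; _++_; tabulate)
open import Data.List.Membership.Propositional using (_∈_; _∉_; find; lose)
open import Data.List.Membership.Propositional.Properties
  using (∈-map⁺; ∈-map⁻; ∈-concatMap⁺; ∈-++⁺ˡ; ∈-++⁺ʳ; ∈-++⁻; ∈-tabulate⁺)
import Data.List.Membership.DecPropositional as DecMembership
open import Data.List.Properties using (tabulate-cong)
open import Data.List.Relation.Binary.Permutation.Propositional using (↭-sym)
open import Data.List.Relation.Binary.Permutation.Propositional.Properties using (∈-resp-↭; shift)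
open import Data.List.Relation.Binary.Subset.Propositional using (_⊆_)
open import Data.List.Relation.Binary.Subset.Propositional.Properties
  using (⊆-refl; ⊆-trans; ∈-∷⁺ʳ)
open import Data.List.Relation.Unary.All as All using (All; []; _∷_)
import Data.List.Relation.Unary.All.Properties as All
open import Data.List.Relation.Unary.Any as Any using (Any; here; there)
open import Data.Maybe.Base using (nothing; just)
open import Data.Product.Base using (_×_; _,_; proj₁; proj₂; Σ-syntax; ∃-syntax)
open import Data.Sum.Base using (_⊎_; inj₁; inj₂; [_,_]′)
open import Data.Vec.Base as Vec using ()
open import Data.Vec.Properties using ([]=⇒lookup; lookup⇒[]=; lookup∘tabulate)
open import Function.Base using (id; _∘_)
open import Function.Bundles using (_⇔_; mk⇔; Equivalence)
open import Relation.Binary.Definitions using (DecidableEquality)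
open import Relation.Binary.PropositionalEquality
  using (_≡_; refl; sym; trans; cong; subst)
open import Relation.Nullary using (¬_; yes; no)

-- Applied with `p` the values of the optimal assignment on the blocking variables and `f` their
-- numeric form, so that the sum is a cost.
∣tabulate∣ : ∀ {n} (p : Fin n → Bool) (f : Fin n → ℕ) →
             (∀ i → p i ≡ true → f i ≡ 1) → (∀ i → p i ≡ false → f i ≡ 0) →
             ∣ Vec.tabulate p ∣ ≡ sum (tabulate f)
∣tabulate∣ {ℕ.zero} p f one nil = refl
∣tabulate∣ {suc n}  p f one nil
  with p zero in eq | ∣tabulate∣ (p ∘ suc) (f ∘ suc) (one ∘ suc) (nil ∘ suc)
... | true  | ih rewrite one zero eq = cong suc ih
... | false | ih rewrite nil zero eq = ih

module _ {V : Set} (_≟_ : DecidableEquality V) where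
  open CostSPR _≟_
  open DecMembership _≟_ using (_∈?_)
  open DecMembership _≟ˡ_ using () renaming (_∈?_ to _∈ˡ?_)

  -- Satisfaction by a true literal

  Satisfies : Substitution → Clause → Set
  Satisfies σ = Any (λ ℓ → applyˡ σ ℓ ≡ bool true)

  Satisfies⇒↾ᶜ : ∀ {σ C} → Satisfies σ C → C ↾ᶜ σ ≡ nothing
  Satisfies⇒↾ᶜ {σ} {ℓ ∷ C} (here eq) with C ↾ᶜ σ
  ... | nothing = ∨-nothing (applyˡ σ ℓ)
    where
    ∨-nothing : ∀ v → v ∨ᵛ nothing ≡ nothing
    ∨-nothing (bool true)  = refl
    ∨-nothing (bool false) = refl
    ∨-nothing (lit _)      = refl
  ... | just _ rewrite eq = refl
  Satisfies⇒↾ᶜ {σ} {ℓ ∷ C} (there s) rewrite Satisfies⇒↾ᶜ s with applyˡ σ ℓ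
  ... | bool true  = refl
  ... | bool false = refl
  ... | lit _      = refl

  -- This is what empties the right-hand side of condition (1) of cost-SPR.
  Satisfies⇒↾ : ∀ {σ Γ} → All (Satisfies σ) Γ → Γ ↾ σ ≡ []
  Satisfies⇒↾ []       = refl
  Satisfies⇒↾ (s ∷ ss) rewrite Satisfies⇒↾ᶜ s = Satisfies⇒↾ ss

  total-applyˡ : ∀ {α} → Total α → ∀ ℓ → ∃[ v ] applyˡ α ℓ ≡ bool v
  total-applyˡ total (pos x) = total x
  total-applyˡ total (neg x) with total x
  ... | v , eq rewrite eq = _ , refl

  total-↾ᶜ : ∀ {α} → Total α → ∀ C → Satisfies α C ⊎ C ↾ᶜ α ≡ just []
  total-↾ᶜ total []      = inj₂ refl
  total-↾ᶜ total (ℓ ∷ C) with total-applyˡ total ℓ | total-↾ᶜ total C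
  ... | true  , eq | _       = inj₁ (here eq)
  ... | false , eq | inj₁ s  = inj₁ (there s)
  ... | false , eq | inj₂ eq′ rewrite eq | eq′ = inj₂ refl

  -- Without a true literal the reduct under a total assignment is the empty clause, which is
  -- neither 1 nor tautological.
  ⊨ᶜ⇒Satisfies : ∀ {α C} → Total α → α ⊨ᶜ C → Satisfies α C
  ⊨ᶜ⇒Satisfies {C = C} total α⊨C with total-↾ᶜ total C
  ... | inj₁ s  = s
  ... | inj₂ eq with α⊨C
  ...   | inj₁ eq′ with () ← trans (sym eq) eq′
  ...   | inj₂ (D , eq′ , x , x∈D , _) with refl ← trans (sym eq) eq′ with () ← x∈D

  -- Variables of clauses and the assignment negating a clause

  vars-⊆-Var : ∀ {Γ C} → C ∈ Γ → vars C ⊆ Var Γ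
  vars-⊆-Var C∈Γ x∈C = ∈-concatMap⁺ vars (Any.map (λ { refl → x∈C }) C∈Γ)

  ∈-vars⁻ : ∀ {x} C → x ∈ vars C → pos x ∈ C ⊎ neg x ∈ C
  ∈-vars⁻ C x∈C with ∈-map⁻ var x∈C
  ... | pos _ , ℓ∈C , refl = inj₁ ℓ∈C
  ... | neg _ , ℓ∈C , refl = inj₂ ℓ∈C

  ∈-complement : ∀ {C ℓ} → var ℓ ∈ vars C → ℓ ∉ C → complement ℓ ∈ C
  ∈-complement {C} {pos x} x∈C ℓ∉C = [ ⊥-elim ∘ ℓ∉C , id ]′ (∈-vars⁻ C x∈C)
  ∈-complement {C} {neg x} x∈C ℓ∉C = [ id , ⊥-elim ∘ ℓ∉C ]′ (∈-vars⁻ C x∈C)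

  -- `¬̇ C` tests `pos x` before `neg x`, so a negative literal of `C` is falsified only if `pos x`
  -- is absent; non-tautology ensures this.
  ¬̇-falsifies : ∀ {C τ ℓ} → ¬ Tautological C → τ ⊇ᵃ (¬̇ C) →
                complement ℓ ∈ C → applyˡ τ ℓ ≡ bool true
  ¬̇-falsifies {C} {τ} {pos x} nontaut τ⊇ ℓ∈C = τ⊇ x true eq
    where
    eq : (¬̇ C) x ≡ bool true
    eq with pos x ∈ˡ? C
    ... | yes p = ⊥-elim (nontaut (x , p , ℓ∈C))
    ... | no  _ with neg x ∈ˡ? C
    ...   | yes _ = refl
    ...   | no ¬q = ⊥-elim (¬q ℓ∈C)
  ¬̇-falsifies {C} {τ} {neg x} nontaut τ⊇ ℓ∈C = cong notᵛ (τ⊇ x false eq)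
    where
    eq : (¬̇ C) x ≡ bool false
    eq with pos x ∈ˡ? C
    ... | yes _ = refl
    ... | no ¬p = ⊥-elim (¬p ℓ∈C)

  Dom-¬̇ : ∀ C x → Dom (¬̇ C) x ⇔ x ∈ vars C
  Dom-¬̇ C x with pos x ∈ˡ? C
  ... | yes p = mk⇔ (λ _ → ∈-map⁺ var p) (λ _ → _ , refl)
  ... | no ¬p with neg x ∈ˡ? C
  ...   | yes q = mk⇔ (λ _ → ∈-map⁺ var q) (λ _ → _ , refl)
  ...   | no ¬q = mk⇔ (λ { (_ , ()) }) (⊥-elim ∘ [ ¬p , ¬q ]′ ∘ ∈-vars⁻ C)

  nontautological-∷ : ∀ {ℓ C} → var ℓ ∉ vars C → ¬ Tautological C → ¬ Tautological (ℓ ∷ C)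
  nontautological-∷ ℓ∉C nontaut (x , here refl , there q) = ℓ∉C (∈-map⁺ var q)
  nontautological-∷ ℓ∉C nontaut (x , there p , here refl) = ℓ∉C (∈-map⁺ var p)
  nontautological-∷ ℓ∉C nontaut (x , there p , there q)   = nontaut (x , p , q)

  -- Restricting a total assignment

  restrict : List V → Substitution → Substitution
  restrict xs α x with x ∈? xs
  ... | yes _ = α x
  ... | no  _ = lit (pos x)

  restrict-∈ : ∀ {xs x} α → x ∈ xs → restrict xs α x ≡ α x
  restrict-∈ {xs} {x} α x∈xs with x ∈? xs
  ... | yes _   = refl
  ... | no x∉xs = ⊥-elim (x∉xs x∈xs)

  restrict-isAssignment : ∀ xs {α} → Total α → IsAssignment (restrict xs α)
  restrict-isAssignment xs total x with x ∈? xs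
  ... | yes _ = inj₁ (total x)
  ... | no  _ = inj₂ refl

  -- Cost-SPR demands a substitution with the same domain as the negated clause, which is why the
  -- optimal assignment is cut down to a list of variables.
  Dom-restrict : ∀ xs {α} → Total α → ∀ x → Dom (restrict xs α) x ⇔ x ∈ xs
  Dom-restrict xs total x with x ∈? xs
  ... | yes x∈xs = mk⇔ (λ _ → x∈xs) (λ _ → total x)
  ... | no  x∉xs = mk⇔ (λ { (_ , ()) }) (⊥-elim ∘ x∉xs)

  restrict-Satisfies : ∀ {xs α C} → vars C ⊆ xs → Satisfies α C → Satisfies (restrict xs α) C
  restrict-Satisfies {xs} {α} C⊆xs s with find s
  ... | pos x , ℓ∈C , eq = lose ℓ∈C (trans (restrict-∈ α (C⊆xs (∈-map⁺ var ℓ∈C))) eq)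
  ... | neg x , ℓ∈C , eq =
    lose ℓ∈C (trans (cong notᵛ (restrict-∈ α (C⊆xs (∈-map⁺ var ℓ∈C)))) eq)

  -- Derivations relative to a fixed optimal assignment

  module _ {m : ℕ} (b : Fin m → V) {Γ : CNF} (b∈Γ : ∀ i → b i ∈ Var Γ)
           {α : Substitution} (total : Total α) (α⊨Γ : α ⊨ Γ)
           (optimal : ∀ τ → Total τ → τ ⊨ Γ → cost b α ≤ cost b τ) where

    σ : Substitution
    σ = restrict (Var Γ) α

    σ-Satisfies-Γ : All (Satisfies σ) Γ
    σ-Satisfies-Γ = All.tabulate λ C∈Γ →
      restrict-Satisfies (vars-⊆-Var C∈Γ) (⊨ᶜ⇒Satisfies total (All.lookup α⊨Γ C∈Γ))

    -- Each `b i` lies in `Var Γ`, so `σ` already sends it to a constant, which `τ` cannot change.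
    cost-σ : ∀ τ → cost b (τ ∘ˢ σ) ≡ cost b α
    cost-σ τ = cong sum (tabulate-cong agree)
      where
      agree : ∀ i → toℕ (applyᵛ τ (σ (b i))) ≡ toℕ (α (b i))
      agree i with total (b i)
      ... | v , eq rewrite restrict-∈ α (b∈Γ i) | eq = refl

    -- Condition (1) also concerns the clauses derived so far, so their satisfaction by `σ` is
    -- carried along as an invariant.
    Sound : List Clause → Set
    Sound Ds = Derivation b Γ Ds × All (Satisfies σ) Ds

    -- Derivability is stated relative to a current derivation: a cost-SPR step refers to everything
    -- before it, so independent derivations cannot simply be concatenated.
    Extension : List Clause → List Clause → Set
    Extension Ds Cs = ∃[ Ds′ ] (Sound Ds′ × Ds ⊆ Ds′ × Cs ⊆ Ds′)

    extend : ∀ {Ds D} → Sound Ds → Step b Γ Ds D → Satisfies σ D → Extension Ds [ D ]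
    extend (d , ss) step s = _ , (step ∷ d , s ∷ ss) , there , λ { (here refl) → here refl }

    infixl 1 _⨾_
    _⨾_ : ∀ {Ds Cs Es} → Extension Ds Cs → (∀ {Ds′} → Sound Ds′ → Extension Ds′ Es) →
          Extension Ds (Cs ++ Es)
    _⨾_ {Cs = Cs} (_ , d , Ds⊆ , Cs⊆) f =
      let _ , d′ , ⊆′ , Es⊆ = f d
      in _ , d′ , ⊆-trans Ds⊆ ⊆′ , λ C∈ → [ ⊆′ ∘ Cs⊆ , Es⊆ ]′ (∈-++⁻ Cs C∈)

    extendʳ : ∀ {Ds Cs D} → Extension Ds Cs → (∀ {Ds′} → Cs ⊆ Ds′ → Step b Γ Ds′ D) →
              Satisfies σ D → Extension Ds [ D ]
    extendʳ (_ , d , Ds⊆ , Cs⊆) step s =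
      let _ , d′ , ⊆′ , D⊆ = extend d (step Cs⊆) s
      in _ , d′ , ⊆-trans Ds⊆ ⊆′ , D⊆

    -- Clauses mentioning all variables of the instance

    full-clause-costSPR : ∀ {Ds D} → All (Satisfies σ) Ds → Satisfies σ D →
                          vars D ⊆ Var Γ → Var Γ ⊆ vars D → ¬ Tautological D →
                          All (λ E → ¬ All (_∈ D) E) Γ → CostSPR b (Γ ++ Ds) D
    full-clause-costSPR {Ds} {D} ss s D⊆Γ Γ⊆D nontaut noSub =
      σ , restrict-isAssignment (Var Γ) total , domain , record
        { nontautological = nontaut
        ; implied         = subst ((Γ ++ Ds) ↾ (¬̇ D) ⊢₁*_)
                              (sym (Satisfies⇒↾ (s ∷ All.++⁺ σ-Satisfies-Γ ss))) []
        ; cost-≤          = λ τ τ-total τ⊇ →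
                              ≤-trans (≤-reflexive (cost-σ τ)) (optimal τ τ-total (models τ⊇))
        }
      where
      module σ-dom x = Equivalence (Dom-restrict (Var Γ) total x)
      module D-dom x = Equivalence (Dom-¬̇ D x)

      domain : ∀ x → Dom σ x ⇔ Dom (¬̇ D) x
      domain x = mk⇔ (D-dom.from x ∘ Γ⊆D ∘ σ-dom.to x) (σ-dom.from x ∘ D⊆Γ ∘ D-dom.to x)

      -- Every clause of `Γ` has a literal outside `D`. Since `D` mentions its variable, `D`
      -- contains the complement, and negating `D` makes the literal true.
      models : ∀ {τ} → τ ⊇ᵃ (¬̇ D) → τ ⊨ Γ
      models {τ} τ⊇ = All.tabulate λ {E} E∈Γ →
        let ℓ , ℓ∈E , ℓ∉D = find (All.¬All⇒Any¬ (_∈ˡ? D) E (All.lookup noSub E∈Γ))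
            ℓ̄∈D = ∈-complement (Γ⊆D (vars-⊆-Var E∈Γ (∈-map⁺ var ℓ∈E))) ℓ∉D
        in inj₁ (Satisfies⇒↾ᶜ (lose ℓ∈E (¬̇-falsifies nontaut τ⊇ ℓ̄∈D)))

    -- If a clause of `Γ` lies inside `D`, every extension of `¬̇ D` falsifies it, so optimality
    -- gives no cost bound; weakening handles exactly this case.
    derive-full : ∀ {Ds D} → Sound Ds → Satisfies σ D →
                  vars D ⊆ Var Γ → Var Γ ⊆ vars D → ¬ Tautological D → Extension Ds [ D ]
    derive-full {Ds} {D} d@(_ , ss) s D⊆Γ Γ⊆D nontaut
      with Any.any? (All.all? (_∈ˡ? D)) Γ
    ... | no none = extend d (redundancy (full-clause-costSPR ss s D⊆Γ Γ⊆D nontaut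
                        (All.¬Any⇒All¬ Γ none)) D⊆Γ) s
    ... | yes some with find some
    ...   | E , E∈Γ , E⊆D =
      extendʳ (extend d (axiom E∈Γ (mk⇔ id id)) (All.lookup σ-Satisfies-Γ E∈Γ))
        (λ E∈ → weakening (E∈ (here refl)) (All.lookup E⊆D)) s

    -- Resolving away the missing variables

    resolve : ∀ {Ds} x {D} → (pos x ∷ D) ∷ (neg x ∷ D) ∷ [] ⊆ Ds → Step b Γ Ds D
    resolve x {D} sub = resolution x D D (sub (here refl)) (sub (there (here refl)))
      -- The resolvent is the list `D ++ D`, which agrees with `D` as a set of literals.
      (mk⇔ id id) (mk⇔ id id) (mk⇔ ([ id , id ]′ ∘ ∈-++⁻ D) (∈-++⁺ʳ D))

    -- Induction on `xs`, a list covering the variables that `D` may still miss; once it is empty,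
    -- `D` mentions all of `Var Γ`.
    derive : ∀ xs → xs ⊆ Var Γ → ∀ {Ds D} → Var Γ ⊆ xs ++ vars D →
             vars D ⊆ Var Γ → ¬ Tautological D → Satisfies σ D →
             Sound Ds → Extension Ds [ D ]
    derive []       xs⊆Γ Γ⊆ D⊆Γ nontaut s d = derive-full d s D⊆Γ Γ⊆ nontaut
    derive (x ∷ xs) xs⊆Γ {D = D} Γ⊆ D⊆Γ nontaut s d with x ∈? vars D
    ... | yes x∈D = derive xs (xs⊆Γ ∘ there)
            (⊆-trans Γ⊆ (∈-∷⁺ʳ (∈-++⁺ʳ xs x∈D) ⊆-refl)) D⊆Γ nontaut s d
    -- Both premises contain `D`, so `σ` satisfies them whatever its value at `x`. The second is
    -- derived on top of the first.
    ... | no  x∉D = extendʳ (branch (pos x) refl d ⨾ branch (neg x) refl) (resolve x) s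
      where
      branch : ∀ ℓ → var ℓ ≡ x → ∀ {Ds} → Sound Ds → Extension Ds [ ℓ ∷ D ]
      branch ℓ refl = derive xs (xs⊆Γ ∘ there)
        -- The variable `x` moves from the pending list to the variables of the longer clause.
        (∈-resp-↭ (↭-sym (shift x xs (vars D))) ∘ Γ⊆)
        (∈-∷⁺ʳ (xs⊆Γ (here refl)) D⊆Γ) (nontautological-∷ x∉D nontaut) (there s)

    derive-all : ∀ {Cs} →
                 All (λ C → vars C ⊆ Var Γ × ¬ Tautological C × Satisfies α C) Cs →
                 ∀ {Ds} → Sound Ds → Extension Ds Cs
    derive-all []                          d = _ , d , ⊆-refl , λ ()
    derive-all ((C⊆Γ , nontaut , s) ∷ Cs) d =
      -- All of `Var Γ` starts out as pending, which makes the covering condition trivial; variables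
      -- already in the clause are skipped.
      derive (Var Γ) ⊆-refl ∈-++⁺ˡ C⊆Γ nontaut (restrict-Satisfies C⊆Γ s) d ⨾ derive-all Cs

    -- Unit clauses on the blocking variables

    optimal-units-derivable :
      Σ[ S ∈ Subset m ] (∣ S ∣ ≡ cost b α ×
        ∃[ Ds ] (Derivation b Γ Ds ×
          (∀ i → i ∈ˢ S → [ pos (b i) ] ∈ Ds) ×
          (∀ j → j ∉ˢ S → [ neg (b j) ] ∈ Ds)))
    optimal-units-derivable =
      let Ds , (d , _) , _ , units⊆Ds = derive-all (All.tabulate⁺ unit-derivable) ([] , [])
      in S , ∣tabulate∣ value _ value-true value-false , Ds , d ,
         (λ i i∈S → units⊆Ds (positive i i∈S)) , (λ j j∉S → units⊆Ds (negative j j∉S))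
      where
      value : Fin m → Bool
      value i = proj₁ (total (b i))

      -- The indices of the blocking variables that `α` sets to 1, so that the size of `S` is the
      -- cost of `α`.
      S : Subset m
      S = Vec.tabulate value

      value-true : ∀ i → value i ≡ true → toℕ (α (b i)) ≡ 1
      value-true i eq rewrite proj₂ (total (b i)) | eq = refl

      value-false : ∀ i → value i ≡ false → toℕ (α (b i)) ≡ 0
      value-false i eq rewrite proj₂ (total (b i)) | eq = refl

      -- The sign follows the value, so `α` satisfies every unit in `units` and one call of
      -- `derive-all` yields both kinds.
      unit : Bool → V → Clause
      unit v x = [ if v then pos x else neg x ]

      units : List Clause
      units = tabulate λ i → unit (value i) (b i)

      unit-derivable : ∀ i → let C = unit (value i) (b i) in
                       vars C ⊆ Var Γ × ¬ Tautological C × Satisfies α C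
      unit-derivable i with total (b i)
      ... | true  , eq = (λ { (here refl) → b∈Γ i }) ,
                         (λ { (_ , here refl , here ()) }) , here eq
      ... | false , eq = (λ { (here refl) → b∈Γ i }) ,
                         (λ { (_ , here () , _) }) , here (cong notᵛ eq)

      unit-∈ : ∀ {v} i → value i ≡ v → unit v (b i) ∈ units
      unit-∈ i refl = ∈-tabulate⁺ i

      positive : ∀ i → i ∈ˢ S → [ pos (b i) ] ∈ units
      positive i i∈S = unit-∈ i (trans (sym (lookup∘tabulate value i)) ([]=⇒lookup i∈S))

      negative : ∀ j → j ∉ˢ S → [ neg (b j) ] ∈ units
      negative j j∉S = unit-∈ j
        (¬-not λ eq → j∉S (lookup⇒[]= j S (trans (lookup∘tabulate value j) eq)))

theorem4p3 : {V : Set} (_≟_ : DecidableEquality V) →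
    let open CostSPR _≟_ in
    (m : ℕ) (I : MaxSATInstance m) (k : ℕ) →
    let open MaxSATInstance I in
    HasCost b cnf k →
    Σ[ S ∈ Subset m ] (∣ S ∣ ≡ k ×
    ∃[ Ds ] (Derivation b cnf Ds ×
    (∀ i → i ∈ˢ S → [ pos (b i) ] ∈ Ds) ×
    (∀ j → j ∉ˢ S → [ neg (b j) ] ∈ Ds)))
-- Matching `refl` identifies `k` with the cost of the optimal assignment `α`.
theorem4p3 _≟_ m I _ ((α , total , α⊨Γ , refl) , optimal) =
  optimal-units-derivable _≟_ b b∈cnf total α⊨Γ optimal
  where
  open CostSPR _≟_
  open MaxSATInstance I

  b∈cnf : ∀ i → b i ∈ Var cnf
  b∈cnf i = vars-⊆-Var _≟_ (∈-++⁺ʳ hard (∈-tabulate⁺ i))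
    (∈-map⁺ var (∈-++⁺ʳ (soft i) (here refl)))
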